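{- Let $G=(V,E)$ be a signed graph which is a complete graph as a non-signed graph. Then $G$ is signed-eliminable if and only if for each $\sigma\in\{+,-\}$, the graph $G_\sigma$ contains, as an induced subgraph, neither a simple path with four vertices, nor a pair of two disjoint edges such that no vertex of one edge is joined by an edge of $G_\sigma$ to a vertex of the other edge.
   Context: All graphs are finite, simple and undirected. A signed graph is a graph $G=(V,E)$ together with a partition $E=E_+\sqcup E_-$ (either part may be empty); put $G_\sigma=(V,E_\sigma)$ for $\sigma\in\{+,-\}$, and let $-\sigma$ be the opposite sign. An ordering on $G$ is a bijection $\nu:V\to\{1,\dots,|V|\}$. It is a signed elimination ordering (SEO) if for every triple $(u,v,w)$ of distinct vertices with $\nu(u)<\nu(w)>\nu(v)$ and each $\sigma\in\{+,-\}$: (E1) if $uw,wv\in E_\sigma$ then $uv\in E_\sigma$; (E2) if $uv\in E_\sigma$ and $vw\in E_{ -\sigma}$ then $uw\in E_\sigma$. $G$ is signed-eliminable if it admits a SEO. -}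

module Defs where

open import Data.Nat using (ℕ; suc)
open import Data.Nat.Properties using (1+n≢n) renaming (_≟_ to _≟ℕ_)
open import Data.Fin using (Fin; toℕ; _<_)
open import Data.Product using (Σ; ∃; _×_)
open import Data.Sign using (Sign; opposite) renaming (+ to s+; - to s-)
open import Data.Sum using (_⊎_; inj₁; inj₂; swap)
open import Function.Bundles using (_⇔_; _⤖_; module Bijection)
open import Function.Definitions using (Injective)
open import Level using (0ℓ)
open import Relation.Binary.Core using (Rel)
open import Relation.Binary.Definitions using (Decidable; Irreflexive; Symmetric)
open import Relation.Binary.PropositionalEquality using (_≡_; _≢_; refl)
open import Relation.Nullary using (¬_)
open import Relation.Nullary.Decidable using (_⊎-dec_)

record Graph (n : ℕ) : Set₁ where
  field
    Adj    : Rel (Fin n) 0ℓ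
    adj?   : Decidable Adj
    sym    : Symmetric Adj
    irrefl : Irreflexive _≡_ Adj

open Graph public using (Adj)

Complete : ∀ {n} → Graph n → Set
Complete G = ∀ u v → u ≢ v → Adj G u v

-- `part σ` is G_σ = (V , E_σ); the last two fields say E = E₊ ⊔ E₋.
record SignedGraph (n : ℕ) : Set₁ where
  field
    graph    : Graph n
    part     : Sign → Graph n
    cover    : ∀ u v → Adj graph u v ⇔ (Adj (part s+) u v ⊎ Adj (part s-) u v)
    disjoint : ∀ u v → ¬ (Adj (part s+) u v × Adj (part s-) u v)

open SignedGraph public using (graph; part)

-- Positions are counted from 0 instead of 1; only their order matters.
Ordering : ℕ → Set
Ordering n = Fin n ⤖ Fin n

record IsSEO {n : ℕ} (G : SignedGraph n) (ν : Ordering n) : Set where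
  open Bijection ν using (to)
  field
    E1 : ∀ u v w → u ≢ v → v ≢ w → u ≢ w → to u < to w → to v < to w →
         ∀ σ → Adj (part G σ) u w → Adj (part G σ) w v → Adj (part G σ) u v
    E2 : ∀ u v w → u ≢ v → v ≢ w → u ≢ w → to u < to w → to v < to w →
         ∀ σ → Adj (part G σ) u v → Adj (part G (opposite σ)) v w →
         Adj (part G σ) u w

SignedEliminable : ∀ {n} → SignedGraph n → Set
SignedEliminable {n} G = Σ (Ordering n) (IsSEO G)

ContainsInduced : ∀ {m n} → Graph n → Graph m → Set
ContainsInduced {m} {n} G H =
  Σ (Fin m → Fin n) λ f →
    Injective _≡_ _≡_ f × (∀ i j → Adj H i j ⇔ Adj G (f i) (f j))

-- The simple path 0 – 1 – ⋯ – (m - 1) with m vertices.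
path : (m : ℕ) → Graph m
path m = record
  { Adj    = λ i j → suc (toℕ i) ≡ toℕ j ⊎ suc (toℕ j) ≡ toℕ i
  ; adj?   = λ i j → (suc (toℕ i) ≟ℕ toℕ j) ⊎-dec (suc (toℕ j) ≟ℕ toℕ i)
  ; sym    = swap
  ; irrefl = λ { refl (inj₁ eq) → 1+n≢n eq ; refl (inj₂ eq) → 1+n≢n eq }
  }

-- Two disjoint edges ab and cd with no edge of the graph between them.
record SeparatedEdges {n : ℕ} (G : Graph n) (a b c d : Fin n) : Set where
  field
    ab  : Adj G a b
    cd  : Adj G c d
    a≢c : a ≢ c
    a≢d : a ≢ d
    b≢c : b ≢ c
    b≢d : b ≢ d
    ¬ac : ¬ Adj G a c
    ¬ad : ¬ Adj G a d
    ¬bc : ¬ Adj G b c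
    ¬bd : ¬ Adj G b d

ContainsSeparatedEdges : ∀ {n} → Graph n → Set
ContainsSeparatedEdges G =
  ∃ λ a → ∃ λ b → ∃ λ c → ∃ λ d → SeparatedEdges G a b c d

{-# OPTIONS --safe #-}
-- On a complete signed graph a SEO is an ordering in which, for no w, two
-- earlier u, v satisfy uw, vw ∈ E_σ and uv ∈ E_{-σ}. Both sides of the
-- equivalence amount to the absence of a closed walk a b c d whose edges
-- alternate in sign: the signs of the diagonals ac, bd make such a cycle an
-- induced path of G_σ or a pair of separated edges of G_σ or G_{-σ}. The last
-- vertex of an alternating cycle violates the SEO condition, whatever the signs
-- of the diagonals. Conversely, without alternating cycles every nonempty set of
-- vertices has a vertex joined to all the others with one sign; removing such
-- vertices one after the other gives a SEO.
module Submission where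

open import Defs
open import Data.Bool using (if_then_else_)
open import Data.Empty using (⊥)
open import Data.Fin using (Fin; zero; suc; _<_; _≤_; punchIn; punchOut)
open import Data.Fin.Patterns using (0F; 1F; 2F; 3F)
open import Data.Fin.Permutation using (Permutation′; _⟨$⟩ʳ_; insert; insert-punchIn)
  renaming (id to idₚ)
open import Data.Fin.Properties
  using (_≟_; any?; <-cmp; <-irrefl; ≤∧≢⇒<; ≤-totalOrder; suc-injective;
    punchIn-injective; punchIn-punchOut)
open import Data.List using (List; []; _∷_)
import Data.List.Extrema
open import Data.List.Relation.Unary.All using (All; []; _∷_)
open import Data.Nat using (ℕ; zero; suc; s≤s; s<s⁻¹)
open import Data.Product using (∃; ∃₂; _×_; _,_; proj₁; proj₂)
open import Data.Sign using (Sign; opposite) renaming (+ to s+; - to s-)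
open import Data.Sign.Properties using (opposite-involutive)
open import Data.Sum using (_⊎_; inj₁; inj₂; swap)
open import Data.Vec using ([]; _∷_; lookup)
open import Function using (_∘_; id)
open import Function.Bundles using (_⇔_; mk⇔; module Bijection; module Equivalence)
open import Function.Definitions using (Injective)
open import Function.Properties.Inverse using (↔⇒⤖)
open import Relation.Binary.Definitions using (tri<; tri≈; tri>)
open import Relation.Binary.PropositionalEquality
  using (_≡_; _≢_; refl; sym; trans; cong; subst; subst₂; ≢-sym)
open import Relation.Nullary using (¬_; Dec; yes; no; does; contradiction)

insert-self : ∀ {m} i j (π : Permutation′ m) → insert i j π ⟨$⟩ʳ i ≡ j
insert-self i j π with i ≟ i
... | yes _  = refl
... | no i≢i = contradiction refl i≢i

-- Edge signs and alternating cycles.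

module _ {n} (G : SignedGraph n) (complete : Complete (graph G)) where
  open SignedGraph G using (cover; disjoint)

  private
    E : Sign → Fin n → Fin n → Set
    E σ = Adj (part G σ)

    E-sym : ∀ {σ u v} → E σ u v → E σ v u
    E-sym {σ} = Graph.sym (part G σ)

    E⇒≢ : ∀ {σ u v} → E σ u v → u ≢ v
    E⇒≢ {σ} uv u≡v = Graph.irrefl (part G σ) u≡v uv

  E-total : ∀ σ {u v} → u ≢ v → E σ u v ⊎ E (opposite σ) u v
  E-total s+ u≢v = Equivalence.to (cover _ _) (complete _ _ u≢v)
  E-total s- u≢v = swap (E-total s+ u≢v)

  E-exclusive : ∀ {σ u v} → E σ u v → ¬ E (opposite σ) u v
  E-exclusive {s+} p q = disjoint _ _ (p , q)
  E-exclusive { s- } p q = disjoint _ _ (q , p)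

  E-unique : ∀ {σ τ u v} → E σ u v → E τ u v → σ ≡ τ
  E-unique {s+} {s+} _ _ = refl
  E-unique {s+} { s- } p q = contradiction q (E-exclusive p)
  E-unique { s- } {s+} p q = contradiction q (E-exclusive p)
  E-unique { s- } { s- } _ _ = refl

  -- For a variable `σ` the double opposite does not compute; this coerces edges when the roles of
  -- the two signs are exchanged.
  E-opposite² : ∀ {σ u v} → E σ u v → E (opposite (opposite σ)) u v
  E-opposite² {σ} {u} {v} = subst (λ τ → E τ u v) (sym (opposite-involutive σ))

  -- The vertices of an alternating cycle are automatically distinct.
  record AlternatingCycle (σ : Sign) (a b c d : Fin n) : Set where
    constructor cycle
    field
      ab : E σ a b
      bc : E (opposite σ) b c
      cd : E σ c d
      da : E (opposite σ) d a

    a≢c : a ≢ c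
    a≢c refl = E-exclusive ab (E-sym bc)

    b≢d : b ≢ d
    b≢d refl = E-exclusive ab (E-sym da)

  open AlternatingCycle

  rotate : ∀ {σ a b c d} → AlternatingCycle σ a b c d → AlternatingCycle (opposite σ) b c d a
  -- Once the sign is concrete, `opposite (opposite σ)` reduces and the same four edges serve.
  rotate {s+} (cycle ab bc cd da) = cycle bc cd da ab
  rotate { s- } (cycle ab bc cd da) = cycle bc cd da ab

  AlternatingCycleFree : Set
  AlternatingCycleFree = ∀ σ a b c d → ¬ AlternatingCycle σ a b c d

  -- Alternating cycles and the forbidden induced subgraphs.

  separatedEdges⇒cycle : ∀ {σ a b c d} → SeparatedEdges (part G σ) a b c d →
                         AlternatingCycle σ a b c d
  separatedEdges⇒cycle {σ} S = cycle S.ab (negative S.b≢c S.¬bc) S.cd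
                                     (E-sym (negative S.a≢d S.¬ad))
    where
    module S = SeparatedEdges S
    negative : ∀ {u v} → u ≢ v → ¬ E σ u v → E (opposite σ) u v
    negative u≢v ¬uv with E-total σ u≢v
    ... | inj₁ uv = contradiction uv ¬uv
    ... | inj₂ uv = uv

  cycle⇒separatedEdges : ∀ {σ a b c d} → AlternatingCycle σ a b c d →
                         E (opposite σ) a c → E (opposite σ) b d →
                         SeparatedEdges (part G σ) a b c d
  cycle⇒separatedEdges C ac bd = record
    { ab  = ab C
    ; cd  = cd C
    ; a≢c = a≢c C
    ; a≢d = ≢-sym (E⇒≢ (da C))
    ; b≢c = E⇒≢ (bc C)
    ; b≢d = b≢d C
    ; ¬ac = λ p → E-exclusive p ac
    ; ¬ad = λ p → E-exclusive p (E-sym (da C))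
    ; ¬bc = λ p → E-exclusive p (bc C)
    ; ¬bd = λ p → E-exclusive p bd
    }

  -- Signs for the pairs `i < j` suffice: an edge of either sign rules out `f i ≡ f j`, which gives
  -- injectivity, and disjointness of the signs turns `opposite σ` into non-adjacency.
  containsInduced : ∀ {m σ} (H : Graph m) (f : Fin m → Fin n) →
    (∀ i j → i < j → E (if does (Graph.adj? H i j) then σ else opposite σ) (f i) (f j)) →
    ContainsInduced (part G σ) H
  containsInduced {m} {σ} H f E-f = f , f-injective , adj⇔
    where
    f-injective : Injective _≡_ _≡_ f
    f-injective {i} {j} fi≡fj with <-cmp i j
    ... | tri< i<j _ _ = contradiction fi≡fj (E⇒≢ (E-f i j i<j))
    ... | tri≈ _ i≡j _ = i≡j
    ... | tri> _ _ j<i = contradiction (sym fi≡fj) (E⇒≢ (E-f j i j<i))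

    adj⇔-< : ∀ i j → i < j → Adj H i j ⇔ E σ (f i) (f j)
    adj⇔-< i j i<j with Graph.adj? H i j | E-f i j i<j
    ... | yes ij | e = mk⇔ (λ _ → e) (λ _ → ij)
    ... | no ¬ij | e = mk⇔ (λ ij → contradiction ij ¬ij) (λ e′ → contradiction e (E-exclusive e′))

    adj⇔ : ∀ i j → Adj H i j ⇔ E σ (f i) (f j)
    adj⇔ i j with <-cmp i j
    ... | tri< i<j _ _ = adj⇔-< i j i<j
    ... | tri≈ _ refl _ = mk⇔ (λ ii → contradiction ii (Graph.irrefl H refl))
                              (λ e → contradiction refl (E⇒≢ e))
    ... | tri> _ _ j<i = mk⇔ (E-sym ∘ Equivalence.to ji ∘ Graph.sym H)
                             (Graph.sym H ∘ Equivalence.from ji ∘ E-sym)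
      where ji = adj⇔-< j i j<i

  inducedPath : ∀ {σ p q r s} → E σ p q → E σ q r → E σ r s →
    E (opposite σ) p r → E (opposite σ) p s → E (opposite σ) q s →
    ContainsInduced (part G σ) (path 4)
  inducedPath {σ} {p} {q} {r} {s} pq qr rs pr ps qs = containsInduced (path 4) f E-f
    where
    f : Fin 4 → Fin n
    f = lookup (p ∷ q ∷ r ∷ s ∷ [])

    E-f : ∀ i j → i < j → E (if does (Graph.adj? (path 4) i j) then σ else opposite σ) (f i) (f j)
    E-f 0F 1F _ = pq
    E-f 0F 2F _ = pr
    E-f 0F 3F _ = ps
    E-f 1F 2F _ = qr
    E-f 1F 3F _ = qs
    E-f 2F 3F _ = rs
    E-f 1F 1F (s≤s ())
    E-f 2F 1F (s≤s ())
    E-f 2F 2F (s≤s (s≤s ()))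
    E-f 3F 1F (s≤s ())
    E-f 3F 2F (s≤s (s≤s ()))
    E-f 3F 3F (s≤s (s≤s (s≤s ())))

  inducedPath⇒cycle : ∀ {σ} → ContainsInduced (part G σ) (path 4) →
                      ∃ λ a → ∃ λ b → ∃ λ c → ∃ λ d → AlternatingCycle σ a b c d
  inducedPath⇒cycle {σ} (f , f-injective , adj⇔) =
    -- The order 0, 1, 3, 2 makes the end edges 01 and 32 the `σ`-sides; the non-edges 13 and 20
    -- give the other two.
    f 0F , f 1F , f 3F , f 2F ,
    cycle (edge 0F 1F (inj₁ refl)) (nonEdge 1F 3F (λ ()) λ { (inj₁ ()) ; (inj₂ ()) })
          (edge 3F 2F (inj₂ refl)) (nonEdge 2F 0F (λ ()) λ { (inj₁ ()) ; (inj₂ ()) })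
    where
    edge : ∀ i j → Adj (path 4) i j → E σ (f i) (f j)
    edge i j = Equivalence.to (adj⇔ i j)

    nonEdge : ∀ i j → i ≢ j → ¬ Adj (path 4) i j → E (opposite σ) (f i) (f j)
    nonEdge i j i≢j ¬ij with E-total σ (i≢j ∘ f-injective)
    ... | inj₁ e = contradiction (Equivalence.from (adj⇔ i j) e) ¬ij
    ... | inj₂ e = e

  Obstructionless : Set
  Obstructionless = (σ : Sign) → ¬ ContainsInduced (part G σ) (path 4)
                               × ¬ ContainsSeparatedEdges (part G σ)

  cycleFree⇒obstructionless : AlternatingCycleFree → Obstructionless
  cycleFree⇒obstructionless free σ =
    (λ P → let (a , b , c , d , C) = inducedPath⇒cycle P in free σ a b c d C) ,
    (λ { (a , b , c , d , S) → free σ a b c d (separatedEdges⇒cycle S) })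

  obstructionless⇒cycleFree : Obstructionless → AlternatingCycleFree
  obstructionless⇒cycleFree free σ a b c d C with E-total σ (a≢c C) | E-total σ (b≢d C)
  -- Both diagonals have sign `σ`, so `bc` and `da` are separated edges of the opposite sign.
  ... | inj₁ ac | inj₁ bd = proj₂ (free (opposite σ))
        (b , c , d , a , cycle⇒separatedEdges (rotate C) (E-opposite² bd) (E-opposite² (E-sym ac)))
  ... | inj₂ ac | inj₂ bd = proj₂ (free σ) (a , b , c , d , cycle⇒separatedEdges C ac bd)
  -- With diagonals of different signs, the three `σ`-edges form an induced path: `b a c d` here,
  -- `a b d c` in the last case.
  ... | inj₁ ac | inj₂ bd = proj₁ (free σ)
        (inducedPath (E-sym (ab C)) ac (cd C) (bc C) bd (E-sym (da C)))
  ... | inj₂ ac | inj₁ bd = proj₁ (free σ)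
        (inducedPath (ab C) bd (E-sym (cd C)) (E-sym (da C)) ac (bc C))

  -- A SEO excludes alternating cycles.

  module _ {ν : Ordering n} (seo : IsSEO G ν) where
    open Bijection ν using (to; injective)
    open IsSEO seo
    open Data.List.Extrema (≤-totalOrder n)

    private
      _≼_ : Fin n → Fin n → Set
      u ≼ v = to u ≤ to v

      ≼∧≢⇒< : ∀ {u v} → u ≼ v → u ≢ v → to u < to v
      ≼∧≢⇒< u≼v u≢v = ≤∧≢⇒< u≼v (u≢v ∘ injective)

    -- By `E1` the edge `uv` would also have sign `σ`. The order may be weak because the edges to
    -- `w` make `u` and `v` differ from it.
    earlierPair : ∀ {σ u v w} → u ≼ w → v ≼ w → E σ u w → E σ w v → ¬ E (opposite σ) u v
    earlierPair u≼w v≼w uw wv uv =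
      E-exclusive
        (E1 _ _ _ (E⇒≢ uv) (≢-sym (E⇒≢ wv)) (E⇒≢ uw)
            (≼∧≢⇒< u≼w (E⇒≢ uw)) (≼∧≢⇒< v≼w (≢-sym (E⇒≢ wv))) _ uw wv)
        uv

    -- The diagonal `ac` shares its sign with one of the sides `ab`, `da`. That side and `ac` join
    -- `a` to two earlier vertices whose own edge, `bc` or `cd`, has the other sign.
    notLast : ∀ {σ a b c d} → AlternatingCycle σ a b c d → b ≼ a → c ≼ a → d ≼ a → ⊥
    notLast {σ} C b≼a c≼a d≼a with E-total σ (a≢c C)
    ... | inj₁ ac = earlierPair b≼a c≼a (E-sym (ab C)) ac (bc C)
    ... | inj₂ ac = earlierPair d≼a c≼a (da C) ac (E-opposite² (E-sym (cd C)))

    seo⇒cycleFree : AlternatingCycleFree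
    seo⇒cycleFree σ a b c d C =
      -- A contradiction is due for each possible last vertex; rotating the cycle brings that vertex
      -- to the front.
      argmax-all to {P = λ m → a ≼ m → All (_≼ m) bcd → ⊥}
        (λ { _ (b≼ ∷ c≼ ∷ d≼ ∷ []) → notLast C b≼ c≼ d≼ })
        ( (λ { a≼ (_ ∷ c≼ ∷ d≼ ∷ []) → notLast C₁ c≼ d≼ a≼ })
        ∷ (λ { a≼ (b≼ ∷ _ ∷ d≼ ∷ []) → notLast C₂ d≼ a≼ b≼ })
        ∷ (λ { a≼ (b≼ ∷ c≼ ∷ _ ∷ []) → notLast C₃ a≼ b≼ c≼ })
        ∷ [])
        (f[⊥]≤f[argmax] {f = to} a bcd)
        (f[xs]≤f[argmax] {f = to} a bcd)
      where
      bcd : List (Fin n)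
      bcd = b ∷ c ∷ d ∷ []
      C₁ = rotate C
      C₂ = rotate C₁
      C₃ = rotate C₂

  -- Construction of a SEO.

  module _ (free : AlternatingCycleFree) where

    -- Induction on the number of vertices, listed by `f`. Let `v` see the old ones with sign `σ`,
    -- and let `x = f 0F` be new. If `xv` has sign `σ`, keep `v`. Otherwise take `x` with the
    -- opposite sign if it has no `σ`-neighbour, and else any `σ`-neighbour `y` of `x`.
    monochromaticVertex : ∀ {m} (f : Fin (suc m) → Fin n) → Injective _≡_ _≡_ f →
      ∃₂ λ v σ → ∀ w → v ≢ w → E σ (f v) (f w)
    -- For a single vertex the sign is arbitrary.
    monochromaticVertex {zero}  f f-injective = 0F , s+ , λ { 0F 0≢0 → contradiction refl 0≢0 }
    monochromaticVertex {suc m} f f-injective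
      with monochromaticVertex (f ∘ suc) (suc-injective ∘ f-injective)
    ... | v , σ , mono with E-total σ {f 0F} {f (suc v)} ((λ ()) ∘ f-injective)
    ...   | inj₁ xv = suc v , σ , λ
      { 0F _ → E-sym xv
      ; (suc w) v≢w → mono w (v≢w ∘ cong suc) }
    ...   | inj₂ xv with any? (λ y → Graph.adj? (part G σ) (f 0F) (f (suc y)))
    ...     | no ∄y = 0F , opposite σ , λ
      { 0F 0≢0 → contradiction refl 0≢0
      ; (suc w) 0≢w → xw w 0≢w }
      where
      xw : ∀ w → 0F ≢ suc w → E (opposite σ) (f 0F) (f (suc w))
      xw w 0≢w with E-total σ (0≢w ∘ f-injective)
      ... | inj₁ xw = contradiction (w , xw) ∄y
      ... | inj₂ xw = xw
    ...     | yes (y , xy) = suc y , σ , λ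
      { 0F _ → E-sym xy
      ; (suc z) y≢z → yz z y≢z }
      where
      vy : E σ (f (suc v)) (f (suc y))
      vy = mono y λ { refl → E-exclusive xy xv }

      yz : ∀ z → suc y ≢ suc z → E σ (f (suc y)) (f (suc z))
      yz z y≢z with E-total σ (y≢z ∘ f-injective)
      ... | inj₁ yz = yz
      -- Otherwise `x y z v` would alternate: `zv` has sign `σ` by the choice of `v`, and `xv` the
      -- opposite one.
      ... | inj₂ yz = contradiction
        (cycle xy yz (E-sym (mono z λ { refl → E-exclusive (E-sym vy) yz })) (E-sym xv))
        (free σ _ _ _ _)

    -- A monochromatic vertex goes first and the recursion orders the rest, where each vertex only
    -- has to see what comes after it.
    monochromaticOrdering : ∀ {m} (f : Fin m → Fin n) → Injective _≡_ _≡_ f →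
      ∃ λ (π : Permutation′ m) → ∀ u → ∃ λ σ →
        ∀ w → π ⟨$⟩ʳ u < π ⟨$⟩ʳ w → E σ (f u) (f w)
    monochromaticOrdering {zero}  f f-injective = idₚ , λ ()
    monochromaticOrdering {suc m} f f-injective
      with v , σ , mono ← monochromaticVertex f f-injective
      with π , ordered ← monochromaticOrdering (f ∘ punchIn v)
                           (punchIn-injective v _ _ ∘ f-injective)
      = π′ , ordered′
      where
      π′ = insert v 0F π

      -- Reduces comparisons in `π′` to two cases: the vertex placed first, or a remaining one,
      -- whose position in `π` is shifted by one.
      position : ∀ w → (v ≡ w × π′ ⟨$⟩ʳ w ≡ 0F) ⊎
                       (∃ λ k → punchIn v k ≡ w × π′ ⟨$⟩ʳ w ≡ suc (π ⟨$⟩ʳ k))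
      position w = decide (v ≟ w)
        where
        decide : Dec (v ≡ w) → _
        decide (yes refl) = inj₁ (refl , insert-self v 0F π)
        decide (no v≢w)   = inj₂ (punchOut v≢w , eq , trans (cong (π′ ⟨$⟩ʳ_) (sym eq)) (insert-punchIn v 0F π _))
          where eq = punchIn-punchOut v≢w

      ordered′ : ∀ u → ∃ λ τ → ∀ w → π′ ⟨$⟩ʳ u < π′ ⟨$⟩ʳ w → E τ (f u) (f w)
      ordered′ u with position u
      ... | inj₁ (refl , _) = σ , λ w v<w → mono w λ v≡w → <-irrefl (cong (π′ ⟨$⟩ʳ_) v≡w) v<w
      ... | inj₂ (k , refl , πu) with τ , after ← ordered k = τ , after′
        where
        after′ : ∀ w → π′ ⟨$⟩ʳ u < π′ ⟨$⟩ʳ w → E τ (f u) (f w)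
        after′ w u<w with position w
        ... | inj₁ (_ , πw)        = contradiction (subst (π′ ⟨$⟩ʳ u <_) πw u<w) λ ()
        ... | inj₂ (l , refl , πw) = after l (s<s⁻¹ (subst₂ _<_ πu πw u<w))

    cycleFree⇒eliminable : SignedEliminable G
    cycleFree⇒eliminable with π , ordered ← monochromaticOrdering id id = ↔⇒⤖ π , record
      { E1 = e1 ; E2 = e2 }
      where
      to = π ⟨$⟩ʳ_

      -- Both edges lead from `u` to later vertices, so both carry the one sign that `ordered`
      -- assigns to `u`.
      forward : ∀ {σ u v w} → to u < to v → to u < to w → E σ u v → E σ u w
      forward {u = u} u<v u<w uv with τ , after ← ordered u
        with refl ← E-unique uv (after _ u<v) = after _ u<w

      distinct : ∀ {u v} → u ≢ v → to u < to v ⊎ to v < to u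
      distinct {u} {v} u≢v with <-cmp (to u) (to v)
      ... | tri< u<v _ _ = inj₁ u<v
      ... | tri≈ _ eq _ = contradiction (Bijection.injective (↔⇒⤖ π) eq) u≢v
      ... | tri> _ _ v<u = inj₂ v<u

      e1 : ∀ u v w → u ≢ v → v ≢ w → u ≢ w → to u < to w → to v < to w →
           ∀ σ → E σ u w → E σ w v → E σ u v
      e1 u v w u≢v _ _ u<w v<w σ uw wv with distinct u≢v
      -- The earlier of `u` and `v` sees the other with the sign it has towards `w`.
      ... | inj₁ u<v = forward u<w u<v uw
      ... | inj₂ v<u = E-sym (forward v<w v<u (E-sym wv))

      e2 : ∀ u v w → u ≢ v → v ≢ w → u ≢ w → to u < to w → to v < to w →
           ∀ σ → E σ u v → E (opposite σ) v w → E σ u w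
      e2 u v w u≢v _ _ u<w v<w σ uv vw with distinct u≢v
      ... | inj₁ u<v = forward u<v u<w uv
      -- With `v` first, `uv` and `vw` share a sign, against the hypotheses of `E2`.
      ... | inj₂ v<u = contradiction vw (E-exclusive (forward v<u v<w (E-sym uv)))

corollary6p4 : (n : ℕ) (G : SignedGraph n) → Complete (graph G) →
    SignedEliminable G ⇔
    ((σ : Sign) → ¬ ContainsInduced (part G σ) (path 4)
    × ¬ ContainsSeparatedEdges (part G σ))
corollary6p4 n G complete = mk⇔
  (λ { (ν , seo) → cycleFree⇒obstructionless G complete (seo⇒cycleFree G complete seo) })
  (λ free → cycleFree⇒eliminable G complete (obstructionless⇒cycleFree G complete free))
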